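{- Let $u_1<u_2<u_3<\cdots$ be the increasing enumeration of the unsums of upper Wythoff numbers, and let $g_n=u_{n+1}-u_n$ for $n\ge 1$ be the sequence of gaps, regarded as an infinite word $g_1g_2g_3\cdots$ over the positive integers. Then there are finite words $W_1,W_2,W_3,\ldots$ over the alphabet $\{3,5\}$, with $W_1=3$, $W_2=33$, $W_3=353$, such that $$g_1g_2g_3\cdots = 1111122121\; 2W_1\,2W_1\,2W_2\,2W_2\,2W_3\,2W_3\,2W_4\,2W_4\cdots$$ and the following hold. (i) Every $W_i$ is a palindrome of length $|W_i|=F_{i+1}$. (ii) For every $i\ge 1$, the sum of the digits of $W_i$ plus $2$ equals $F_{i+4}$. (iii) For every $n\ge 3$, the words $W_{n+1}$ and $W_n$ agree on their first $\lceil |W_{n+1}|/2\rceil$ letters. (iv) The words $W_n$ converge (letter by letter) to the infinite word $3\,\mathbf{F}'$, where $\mathbf{F}'$ is obtained from the Fibonacci word $\mathbf{F}$ by replacing each $a$ by $5$ and each $b$ by $3$.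
   Context: The Fibonacci numbers are $F_0=0$, $F_1=1$, $F_{n+2}=F_{n+1}+F_n$. The Fibonacci word $\mathbf{F}=abaababaabaab\cdots$ is the infinite word beginning with $a$ that is fixed by the substitution $a\mapsto ab$, $b\mapsto a$. The upper Wythoff numbers $2,5,7,10,13,15,18,20,23,26,28,31,\ldots$ are the positions of the letter $b$ in $\mathbf{F}$, with positions counted starting from $1$. An unsum is a positive integer that is not the sum of two distinct upper Wythoff numbers (OEIS A260317; it starts $1,2,3,4,5,6,8,10,11,13,14,16,19,\ldots$); the sequence of gaps is OEIS A260311. A palindrome is a finite word equal to its reversal. -}

module Defs where

open import Data.List.Base
  using (List; []; _∷_; [_]; _++_; length; head; drop; concatMap; applyUpTo)
open import Data.List.Properties using (++-assoc; ++-identityʳ; concatMap-++; length-++; ∷-injective)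
open import Data.Maybe.Base using (Maybe; just; fromMaybe)
open import Data.Nat.Base using (ℕ; zero; suc; _+_; _∸_; _<_; _≤_; z≤n; s≤s)
open import Data.Nat.GeneralisedArithmetic using (fold)
open import Data.Nat.Properties
  using (≤-total; ≤-trans; ≤-reflexive; <⇒≤; m∸n+n≡m; m+[n∸m]≡n; +-monoʳ-≤; +-comm)
open import Data.Product.Base using (∃; ∃₂; _×_; _,_)
open import Data.Sum.Base using (inj₁; inj₂)
open import Function.Bundles using (_⇔_)
open import Relation.Binary.Definitions using (Monotonic₁)
open import Relation.Binary.PropositionalEquality
  using (_≡_; _≢_; refl; sym; trans; cong; cong₂; subst; module ≡-Reasoning)
open import Relation.Nullary.Negation.Core using (¬_)

fib : ℕ → ℕ
fib 0             = 0
fib 1             = 1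
fib (suc (suc n)) = fib (suc n) + fib n

-- An infinite word over A is a function x : ℕ → A; x k is its letter at
-- position k + 1 (positions are counted from 1 in the mathematics).

letterAt : {A : Set} → List A → ℕ → Maybe A
letterAt w k = head (drop k w)

_IsPrefixOf_ : {A : Set} → List A → (ℕ → A) → Set
w IsPrefixOf x = applyUpTo x (length w) ≡ w

-- In particular, W n has a letter at position k for all large n.
_ConvergesTo_ : {A : Set} → (ℕ → List A) → (ℕ → A) → Set
W ConvergesTo x = ∀ k → ∃ λ N → ∀ n → N ≤ n → letterAt (W n) k ≡ just (x k)

data Letter : Set where
  a b : Letter

φ : Letter → List Letter
φ a = a ∷ b ∷ []
φ b = a ∷ []

φⁿ[a] : ℕ → List Letter
φⁿ[a] = fold [ a ] (concatMap φ)

-- φⁿ(a) has more than n letters, so the default letter is never used.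
-- The defining properties are fibWord-starts and fibWord-fixed below.
fibWord : ℕ → Letter
fibWord n = fromMaybe a (letterAt (φⁿ[a] n) n)

UpperWythoff : ℕ → Set
UpperWythoff m = ∃ λ k → m ≡ suc k × fibWord k ≡ b

Unsum : ℕ → Set
Unsum m = 0 < m × ¬ (∃₂ λ x y → UpperWythoff x × UpperWythoff y × x ≢ y × m ≡ x + y)

-- The enumeration starts at index 0, so u k is the (k + 1)-st element.
IsIncreasingEnumeration : (ℕ → Set) → (ℕ → ℕ) → Set
IsIncreasingEnumeration P u = Monotonic₁ _<_ _<_ u × (∀ m → P m ⇔ (∃ λ k → u k ≡ m))

-- Used only for increasing u, where ∸ is true subtraction.
gaps : (ℕ → ℕ) → (ℕ → ℕ)
gaps u k = u (suc k) ∸ u k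

-- 2W₁ 2W₁ 2W₂ 2W₂ ⋯ 2Wₙ 2Wₙ (W 0 is not used)
doubledBlocks : (ℕ → List ℕ) → ℕ → List ℕ
doubledBlocks W zero    = []
doubledBlocks W (suc n) =
  doubledBlocks W n ++ (2 ∷ W (suc n)) ++ (2 ∷ W (suc n))

-- The infinite word x = p 2W₁ 2W₁ 2W₂ 2W₂ ⋯. The prefixes have unbounded
-- length, so they determine x.
_IsDoubledConcatenationOf_After_ : (ℕ → ℕ) → (ℕ → List ℕ) → List ℕ → Set
x IsDoubledConcatenationOf W After p = ∀ n → (p ++ doubledBlocks W n) IsPrefixOf x

digit : Letter → ℕ
digit a = 5
digit b = 3

fibWord′ : ℕ → ℕ
fibWord′ k = digit (fibWord k)

_◂_ : {A : Set} → A → (ℕ → A) → (ℕ → A)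
(d ◂ x) zero    = d
(d ◂ x) (suc k) = x k

fibWord-starts : fibWord 0 ≡ a
fibWord-starts = refl

private
  letterAt-++ : {A : Set} (xs ys : List A) (k : ℕ) → k < length xs →
                letterAt (xs ++ ys) k ≡ letterAt xs k
  letterAt-++ (x ∷ xs) ys zero    _       = refl
  letterAt-++ (x ∷ xs) ys (suc k) (s≤s p) = letterAt-++ xs ys k p

  letterAt-just : {A : Set} (d : A) (xs : List A) (k : ℕ) → k < length xs →
                  letterAt xs k ≡ just (fromMaybe d (letterAt xs k))
  letterAt-just d (x ∷ xs) zero    _       = refl
  letterAt-just d (x ∷ xs) (suc k) (s≤s p) = letterAt-just d xs k p

  letters⇒prefix : {A : Set} (w : List A) (x : ℕ → A) →
                   (∀ k → k < length w → letterAt w k ≡ just (x k)) → w IsPrefixOf x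
  letters⇒prefix []      x h = refl
  letters⇒prefix (c ∷ w) x h with refl ← h 0 (s≤s z≤n) =
    cong (x 0 ∷_) (letters⇒prefix w (λ k → x (suc k)) (λ k p → h (suc k) (s≤s p)))

  prefix-++ : {A : Set} (w v : List A) (x : ℕ → A) →
              (w ++ v) IsPrefixOf x → w IsPrefixOf x
  prefix-++ []      v x h = refl
  prefix-++ (c ∷ w) v x h with ∷-injective h
  ... | x0≡c , h′ = cong₂ _∷_ x0≡c (prefix-++ w v (λ k → x (suc k)) h′)

  applyUpTo-+ : {A : Set} (x : ℕ → A) (m n : ℕ) →
                ∃ λ ys → applyUpTo x (m + n) ≡ applyUpTo x m ++ ys
  applyUpTo-+ x zero    n = applyUpTo x n , refl
  applyUpTo-+ x (suc m) n with applyUpTo-+ (λ k → x (suc k)) m n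
  ... | ys , eq = ys , cong (x 0 ∷_) eq

  φ-nonempty : ∀ c cs → ∃₂ λ d ds → concatMap φ (c ∷ cs) ≡ d ∷ ds
  φ-nonempty a cs = _ , _ , refl
  φ-nonempty b cs = _ , _ , refl

  φⁿ-step : ∀ n → ∃₂ λ c cs → φⁿ[a] (suc n) ≡ φⁿ[a] n ++ c ∷ cs
  φⁿ-step zero = b , [] , refl
  φⁿ-step (suc n) with φⁿ-step n
  ... | c , cs , eq with φ-nonempty c cs
  ...   | d , ds , eq′ = d , ds ,
          trans (cong (concatMap φ) eq)
            (trans (concatMap-++ φ (φⁿ[a] n) (c ∷ cs))
                   (cong (φⁿ[a] (suc n) ++_) eq′))

  φⁿ-extend : ∀ n m → ∃ λ ys → φⁿ[a] (n + m) ≡ φⁿ[a] m ++ ys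
  φⁿ-extend zero    m = [] , sym (++-identityʳ _)
  φⁿ-extend (suc n) m with φⁿ-extend n m | φⁿ-step (n + m)
  ... | ys , eq | c , cs , eq′ = ys ++ c ∷ cs ,
        trans eq′ (trans (cong (_++ c ∷ cs) eq) (++-assoc (φⁿ[a] m) ys (c ∷ cs)))

  φⁿ-≤ : ∀ {m n} → m ≤ n → ∃ λ ys → φⁿ[a] n ≡ φⁿ[a] m ++ ys
  φⁿ-≤ {m} {n} m≤n with φⁿ-extend (n ∸ m) m
  ... | ys , eq = ys , subst (λ k → φⁿ[a] k ≡ φⁿ[a] m ++ ys) (m∸n+n≡m m≤n) eq

  φⁿ-length : ∀ n → n < length (φⁿ[a] n)
  φⁿ-length zero = s≤s z≤n
  φⁿ-length (suc n) with φⁿ-step n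
  ... | c , cs , eq = ≤-trans (s≤s (φⁿ-length n))
        (≤-trans (≤-reflexive (+-comm 1 _))
          (≤-trans (+-monoʳ-≤ (length (φⁿ[a] n)) (s≤s z≤n))
            (≤-reflexive (sym (trans (cong length eq) (length-++ (φⁿ[a] n)))))))

  φⁿ-letter : ∀ m k → k < length (φⁿ[a] m) → letterAt (φⁿ[a] m) k ≡ just (fibWord k)
  φⁿ-letter m k k<l with letterAt-just a (φⁿ[a] k) k (φⁿ-length k) | ≤-total m k
  ... | here | inj₁ m≤k with φⁿ-≤ m≤k
  ...   | ys , eq = trans (sym (letterAt-++ (φⁿ[a] m) ys k k<l))
                      (trans (cong (λ w → letterAt w k) (sym eq)) here)
  φⁿ-letter m k k<l | here | inj₂ k≤m with φⁿ-≤ k≤m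
  ...   | ys , eq = trans (cong (λ w → letterAt w k) eq)
                      (trans (letterAt-++ (φⁿ[a] k) ys k (φⁿ-length k)) here)

φⁿ[a]-prefix : ∀ n → φⁿ[a] n IsPrefixOf fibWord
φⁿ[a]-prefix n = letters⇒prefix (φⁿ[a] n) fibWord (φⁿ-letter n)

fibWord-fixed : ∀ n → concatMap φ (applyUpTo fibWord n) IsPrefixOf fibWord
fibWord-fixed n with applyUpTo-+ fibWord n (length (φⁿ[a] n) ∸ n)
... | ys , eq = prefix-++ _ (concatMap φ ys) fibWord
                  (subst (_IsPrefixOf fibWord) split (φⁿ[a]-prefix (suc n)))
  where
  open ≡-Reasoning
  split : φⁿ[a] (suc n) ≡ concatMap φ (applyUpTo fibWord n) ++ concatMap φ ys
  split = begin
    concatMap φ (φⁿ[a] n)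
      ≡⟨ cong (concatMap φ) (φⁿ[a]-prefix n) ⟨
    concatMap φ (applyUpTo fibWord (length (φⁿ[a] n)))
      ≡⟨ cong (λ l → concatMap φ (applyUpTo fibWord l)) (m+[n∸m]≡n (<⇒≤ (φⁿ-length n))) ⟨
    concatMap φ (applyUpTo fibWord (n + (length (φⁿ[a] n) ∸ n)))
      ≡⟨ cong (concatMap φ) eq ⟩
    concatMap φ (applyUpTo fibWord n ++ ys)
      ≡⟨ concatMap-++ φ (applyUpTo fibWord n) ys ⟩
    concatMap φ (applyUpTo fibWord n) ++ concatMap φ ys ∎

{-# OPTIONS --safe #-}
module Submission where

-- Write ℓ x for the letter of the Fibonacci word at position x and F m for
-- the Fibonacci numbers. The proof rests on two symmetries,
--   ℓ (F m + x) = ℓ x  for 1 ≤ x ≤ F (m + 1) - 2,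
--   ℓ x = ℓ y          for x + y = F m - 1,
-- and on the absence of the factor bb. If F m or F m - 2 were a sum x + y
-- of two positions of b, the mirror image of x would be a b adjacent to y;
-- shifting by F m then excludes 2 F m and 2 F m - 2, where now x = y = F m
-- is the reason why the summands must be distinct. The same two moves show
-- that no position of the first letter of a factor aa is a sum. All other
-- x ≥ 14 are sums with a summand F m or F m - 1, whichever carries a b.
-- So between consecutive centres c, the numbers F m and 2 F m, the unsums
-- are the translates by c of the first positions of aa, together with c and
-- c - 2; the positions of aa have the gaps 5 and 3 of F′ because the word is
-- made of blocks abaab and aba.

open import Defs
open import Data.List.Base using (List; []; _∷_; length; reverse; sum; take)
open import Data.List.Relation.Unary.All using (All)
open import Data.Nat.Base using (ℕ; _+_; _≤_; ⌈_/2⌉)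
open import Data.Product.Base using (∃; _×_)
open import Data.Sum.Base using (_⊎_)
open import Relation.Binary.PropositionalEquality using (_≡_)

open import Data.Empty using (⊥; ⊥-elim)
open import Data.List.Base using (_++_; [_]; applyUpTo; applyDownFrom; concatMap)
open import Data.List.Properties
  using (concatMap-++; length-++; length-applyUpTo; ∷-injective; ++-assoc; reverse-++; unfold-reverse; reverse-applyUpTo)
import Data.List.Relation.Unary.All as All
import Data.List.Relation.Unary.All.Properties as All
open import Data.Maybe.Base using (just)
open import Data.Nat.Base using (zero; suc; _<_; _∸_; z≤n; s≤s; z<s; s<s)
import Data.Nat.ListAction as ListAction
open import Data.Nat.ListAction.Properties using (sum-++)
open import Data.Nat.Properties
open import Data.Nat.Tactic.RingSolver using (solve)
open import Data.Product.Base using (∃₂; _,_; proj₁; proj₂)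
open import Data.Sum.Base using (inj₁; inj₂)
open import Function.Base using (_∘_)
open import Function.Bundles using (mk⇔; Equivalence)
open import Relation.Binary.Definitions using (tri<; tri≈; tri>)
open import Relation.Binary.PropositionalEquality
  using (_≢_; refl; sym; trans; cong; cong₂; subst; module ≡-Reasoning)
open import Relation.Nullary.Decidable using (yes; no; True; False; map′; _×-dec_; ¬?; toWitness; toWitnessFalse)
open import Relation.Nullary.Negation using (¬_)
open import Relation.Unary using (Decidable)

-- The slack k and the moved terms leave only semiring identities to check.

≤-linear : ∀ k {l r l′ r′} → l′ ≤ r′ → l + r′ + k ≡ r + l′ → l ≤ r
≤-linear k {l} {r} {l′} {r′} l′≤r′ eq = +-cancelʳ-≤ r′ l r (begin
  l + r′      ≤⟨ m≤m+n (l + r′) k ⟩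
  l + r′ + k  ≡⟨ eq ⟩
  r + l′      ≤⟨ +-monoʳ-≤ r l′≤r′ ⟩
  r + r′      ∎)
  where open ≤-Reasoning

≡-linear : ∀ {l r l′ r′} → l′ ≡ r′ → l + r′ ≡ r + l′ → l ≡ r
≡-linear {l} {r} {l′} refl eq = +-cancelʳ-≡ l′ l r eq

≤⇒⊥ : ∀ k {l r} → l ≤ r → l ≡ r + suc k → ⊥
≤⇒⊥ k {l} {r} l≤r refl = m+1+n≰m r l≤r

≤⇒∃ : ∀ {m n} → m ≤ n → ∃ λ k → k + m ≡ n
≤⇒∃ {m} {n} m≤n = n ∸ m , m∸n+n≡m m≤n

<⇒∃ : ∀ {m n} → m < n → ∃ λ k → suc k + m ≡ n
<⇒∃ m<n with k , eq ← ≤⇒∃ m<n = k , trans (sym (+-suc k _)) eq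

-- Fibonacci numbers

1≤fib : ∀ n → 1 ≤ fib (suc n)
1≤fib zero    = s≤s z≤n
1≤fib (suc n) = ≤-trans (1≤fib n) (m≤m+n _ _)

fib≤fib-suc : ∀ n → fib n ≤ fib (suc n)
fib≤fib-suc zero    = z≤n
fib≤fib-suc (suc n) = m≤m+n _ _

2≤fib : ∀ n → 2 ≤ fib (3 + n)
2≤fib n = +-mono-≤ (1≤fib (suc n)) (1≤fib n)

3≤fib : ∀ n → 3 ≤ fib (4 + n)
3≤fib n = +-mono-≤ (2≤fib n) (1≤fib (suc n))

5≤fib : ∀ n → 5 ≤ fib (5 + n)
5≤fib n = +-mono-≤ (3≤fib n) (2≤fib n)

-- Removing the largest Fibonacci number F (n + 3) not exceeding x leaves less than F (n + 2), the
-- range in which `fibWord-repeats` applies. The strong inductions on positions run on this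
-- remainder.
fib-decompose : ∀ x → 2 ≤ x → ∃₂ λ n t → t < fib (2 + n) × t + fib (3 + n) ≡ x
fib-decompose (suc zero) (s≤s ())
fib-decompose (suc (suc zero)) _ = 0 , 0 , z<s , refl
fib-decompose (suc (suc (suc x))) _ with fib-decompose (suc (suc x)) (s≤s (s≤s z≤n))
... | n , t , t< , eq with m≤n⇒m<n∨m≡n t<
...   | inj₁ t+1< = n , suc t , t+1< , cong suc eq
...   | inj₂ t+1≡ = suc n , 0 , 1≤fib (2 + n) ,
        trans (+-comm (fib (3 + n)) (fib (2 + n))) (trans (cong (_+ fib (3 + n)) (sym t+1≡)) (cong suc eq))

-- Initial segments of infinite words

applyUpTo-+ : ∀ {A : Set} (f : ℕ → A) m n →
              applyUpTo f (m + n) ≡ applyUpTo f m ++ applyUpTo (λ i → f (m + i)) n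
applyUpTo-+ f zero    n = refl
applyUpTo-+ f (suc m) n = cong (f 0 ∷_) (applyUpTo-+ (f ∘ suc) m n)

applyUpTo-cong : ∀ {A : Set} {f g : ℕ → A} n → (∀ i → i < n → f i ≡ g i) →
                 applyUpTo f n ≡ applyUpTo g n
applyUpTo-cong zero    f≗g = refl
applyUpTo-cong (suc n) f≗g =
  cong₂ _∷_ (f≗g 0 z<s) (applyUpTo-cong n (λ i i<n → f≗g (suc i) (s<s i<n)))

applyUpTo-injective : ∀ {A : Set} {f g : ℕ → A} n → applyUpTo f n ≡ applyUpTo g n →
                      ∀ i → i < n → f i ≡ g i
applyUpTo-injective (suc n) eq zero    _         = proj₁ (∷-injective eq)
applyUpTo-injective (suc n) eq (suc i) (s≤s i<n) =
  applyUpTo-injective n (proj₂ (∷-injective eq)) i i<n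

++-cancel-length : ∀ {A : Set} (u v : List A) {u′ v′} → length u ≡ length u′ →
                   u ++ v ≡ u′ ++ v′ → v ≡ v′
++-cancel-length []      v {[]}     _   eq = eq
++-cancel-length (x ∷ u) v {y ∷ u′} len eq =
  ++-cancel-length u v (suc-injective len) (proj₂ (∷-injective eq))

IsPrefixOf-++ : ∀ {A : Set} (u v : List A) (x : ℕ → A) → (u ++ v) IsPrefixOf x →
                v IsPrefixOf (λ i → x (length u + i))
IsPrefixOf-++ u v x eq = ++-cancel-length (applyUpTo x (length u)) _ (length-applyUpTo x (length u))
  (trans (sym (applyUpTo-+ x (length u) (length v)))
    (subst (λ n → applyUpTo x n ≡ u ++ v) (length-++ u) eq))

-- The Fibonacci word

φⁿ[a]-rec : ∀ n → φⁿ[a] (2 + n) ≡ φⁿ[a] (1 + n) ++ φⁿ[a] n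
φⁿ[a]-rec zero    = refl
φⁿ[a]-rec (suc n) =
  trans (cong (concatMap φ) (φⁿ[a]-rec n)) (concatMap-++ φ (φⁿ[a] (1 + n)) (φⁿ[a] n))

length-φⁿ[a] : ∀ n → length (φⁿ[a] n) ≡ fib (2 + n)
length-φⁿ[a] zero          = refl
length-φⁿ[a] (suc zero)    = refl
length-φⁿ[a] (suc (suc n)) = begin
  length (φⁿ[a] (2 + n))                    ≡⟨ cong length (φⁿ[a]-rec n) ⟩
  length (φⁿ[a] (1 + n) ++ φⁿ[a] n)         ≡⟨ length-++ (φⁿ[a] (1 + n)) ⟩
  length (φⁿ[a] (1 + n)) + length (φⁿ[a] n) ≡⟨ cong₂ _+_ (length-φⁿ[a] (suc n)) (length-φⁿ[a] n) ⟩
  fib (4 + n)                               ∎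
  where open ≡-Reasoning

-- The prefix φⁿ⁺²(a) equals φⁿ⁺¹(a) φⁿ(a), so a second copy of φⁿ(a), of length F (n + 2), begins
-- at index F (n + 3).
fibWord-repeats : ∀ n i → i < fib (2 + n) → fibWord (i + fib (3 + n)) ≡ fibWord i
fibWord-repeats n i i< =
  trans (cong fibWord (trans (+-comm i _) (cong (_+ i) (sym (length-φⁿ[a] (1 + n))))))
    (applyUpTo-injective (length (φⁿ[a] n)) tail i (subst (i <_) (sym (length-φⁿ[a] n)) i<))
  where
  tail : applyUpTo (λ j → fibWord (length (φⁿ[a] (1 + n)) + j)) (length (φⁿ[a] n)) ≡
         applyUpTo fibWord (length (φⁿ[a] n))
  tail = trans
    (IsPrefixOf-++ (φⁿ[a] (1 + n)) (φⁿ[a] n) fibWord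
      (subst (_IsPrefixOf fibWord) (φⁿ[a]-rec n) (φⁿ[a]-prefix (2 + n))))
    (sym (φⁿ[a]-prefix n))

private
  -- Beyond the reach of `fibWord-repeats`, write i = j + F (n + 3). Then i + F (n + 4) = j + F (n +
  -- 5) carries the letter of j by a repetition at the next Fibonacci number, and so does i by the
  -- hypothesis.
  shift-step : ∀ n → (∀ i → 3 + i ≤ fib (4 + n) → fibWord (i + fib (3 + n)) ≡ fibWord i) →
               ∀ i → 3 + i ≤ fib (5 + n) → fibWord (i + fib (4 + n)) ≡ fibWord i
  shift-step n ih i i≤ with <-≤-connex i (fib (3 + n))
  ... | inj₁ i< = fibWord-repeats (1 + n) i i<
  ... | inj₂ i≥ with j , refl ← ≤⇒∃ i≥ = begin
    fibWord (j + fib (3 + n) + fib (4 + n)) ≡⟨ cong fibWord (arrange j _ _) ⟩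
    fibWord (j + fib (5 + n))               ≡⟨ fibWord-repeats (2 + n) j (≤-trans (m≤n+m _ 2) j≤) ⟩
    fibWord j                               ≡⟨ ih j j≤ ⟨
    fibWord (j + fib (3 + n))               ∎
    where
    open ≡-Reasoning
    arrange : ∀ j p q → j + p + q ≡ j + (q + p)
    arrange j p q = solve (j ∷ p ∷ q ∷ [])
    bound : ∀ j p q → 3 + (j + p) ≤ q + p → 3 + j ≤ q
    bound j p q h = ≤-linear 0 h (solve (j ∷ p ∷ q ∷ []))
    j≤ : 3 + j ≤ fib (4 + n)
    j≤ = bound j _ _ i≤

fibWord-shift : ∀ m i → 3 + i ≤ fib (suc m) → fibWord (i + fib m) ≡ fibWord i
fibWord-shift 0 i (s≤s ())
fibWord-shift 1 i (s≤s ())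
fibWord-shift 2 i (s≤s (s≤s ()))
fibWord-shift 3 zero    _                    = refl
fibWord-shift 3 (suc i) (s≤s (s≤s (s≤s ())))
fibWord-shift (suc m@(suc (suc (suc n)))) = shift-step n (fibWord-shift m)

private
  -- An index that is at least F (k + 4) can be shifted down by that number, which turns the sum F
  -- (k + 6) - 3 into F (k + 5) - 3. If both indices were smaller, their sum would be at most 2 F (k
  -- + 4) - 2, which is too small.
  mirror-step : ∀ k → (∀ i j → 3 + (i + j) ≡ fib (5 + k) → fibWord i ≡ fibWord j) →
                ∀ i j → 3 + (i + j) ≡ fib (6 + k) → fibWord i ≡ fibWord j
  mirror-step k ih i j eq with <-≤-connex i (fib (4 + k)) | <-≤-connex j (fib (4 + k))
  ... | inj₂ i≥ | _ with i′ , refl ← ≤⇒∃ i≥ =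
    trans (fibWord-shift (4 + k) i′ (bound i′ j _ eq′)) (ih i′ j eq′)
    where
    cancel : ∀ i j g h → 3 + (i + g + j) ≡ h + g → 3 + (i + j) ≡ h
    cancel i j g h e = ≡-linear e (solve (i ∷ j ∷ g ∷ h ∷ []))
    bound : ∀ i j h → 3 + (i + j) ≡ h → 3 + i ≤ h
    bound i j _ refl = m≤m+n (3 + i) j
    eq′ : 3 + (i′ + j) ≡ fib (5 + k)
    eq′ = cancel i′ j _ _ eq
  ... | inj₁ _ | inj₂ j≥ with j′ , refl ← ≤⇒∃ j≥ =
    trans (ih i j′ eq′) (sym (fibWord-shift (4 + k) j′ (bound i j′ _ eq′)))
    where
    cancel : ∀ i j g h → 3 + (i + (j + g)) ≡ h + g → 3 + (i + j) ≡ h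
    cancel i j g h e = ≡-linear e (solve (i ∷ j ∷ g ∷ h ∷ []))
    bound : ∀ i j h → 3 + (i + j) ≡ h → 3 + j ≤ h
    bound i j _ refl = +-monoʳ-≤ 3 (m≤n+m j i)
    eq′ : 3 + (i + j′) ≡ fib (5 + k)
    eq′ = cancel i j′ _ _ eq
  ... | inj₁ i< | inj₁ j< = ⊥-elim (clash i j _ _ (2≤fib k) i< j< eq)
    where
    clash : ∀ i j g h → 2 ≤ h → i < g → j < g → 3 + (i + j) ≡ (g + h) + g → ⊥
    clash i j g h 2≤h i<g j<g e =
      ≤⇒⊥ 0 (+-mono-≤ 2≤h (+-mono-≤ i<g j<g)) (≡-linear e (solve (i ∷ j ∷ g ∷ h ∷ [])))

-- The prefix of length F m - 2 is a palindrome. The inductive step needs F (m - 3) ≥ 2, so the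
-- prefixes a and aba, for m = 4 and m = 5, are checked directly.
fibWord-mirror : ∀ m i j → 3 + (i + j) ≡ fib m → fibWord i ≡ fibWord j
fibWord-mirror 0 i j ()
fibWord-mirror 1 i j ()
fibWord-mirror 2 i j ()
fibWord-mirror 3 i j ()
fibWord-mirror 4 zero    zero    _  = refl
fibWord-mirror 4 zero    (suc j) ()
fibWord-mirror 4 (suc i) j       ()
fibWord-mirror 5 0 0 ()
fibWord-mirror 5 0 1 ()
fibWord-mirror 5 0 2 _ = refl
fibWord-mirror 5 0 (suc (suc (suc j))) ()
fibWord-mirror 5 1 0 ()
fibWord-mirror 5 1 1 _ = refl
fibWord-mirror 5 1 (suc (suc j)) ()
fibWord-mirror 5 2 0 _ = refl
fibWord-mirror 5 2 (suc j) ()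
fibWord-mirror 5 (suc (suc (suc i))) j ()
fibWord-mirror (suc m@(suc (suc (suc (suc (suc k)))))) = mirror-step k (fibWord-mirror m)

-- Position 0 does not occur in the word; it carries the letter a so that
-- b's are exactly the upper Wythoff numbers.
letter : ℕ → Letter
letter zero    = a
letter (suc i) = fibWord i

IsB : ℕ → Set
IsB x = letter x ≡ b

IsAA : ℕ → Set
IsAA x = letter x ≡ a × letter (suc x) ≡ a

a≢b : a ≢ b
a≢b ()

letter-shift : ∀ m x → 1 ≤ x → 2 + x ≤ fib (suc m) → letter (x + fib m) ≡ letter x
letter-shift m (suc i) _ = fibWord-shift m i

letter-mirror : ∀ m x y → 1 ≤ x → 1 ≤ y → suc (x + y) ≡ fib m → letter x ≡ letter y
letter-mirror m (suc i) (suc j) _ _ eq = fibWord-mirror m i j (trans (cong (2 +_) (sym (+-suc i j))) eq)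

IsAA-shift : ∀ m x → 1 ≤ x → 3 + x ≤ fib (suc m) → IsAA x → IsAA (x + fib m)
IsAA-shift m x 1≤x x≤ (p , q) =
  trans (letter-shift m x 1≤x (≤-trans (n≤1+n _) x≤)) p , trans (letter-shift m (suc x) z<s x≤) q

IsB⇒2≤ : ∀ {x} → IsB x → 2 ≤ x
IsB⇒2≤ {zero} ()
IsB⇒2≤ {suc zero} ()
IsB⇒2≤ {suc (suc x)} _ = s≤s (s≤s z≤n)

IsB⇒1≤ : ∀ {x} → IsB x → 1 ≤ x
IsB⇒1≤ = ≤-trans (n≤1+n 1) ∘ IsB⇒2≤

private
  rest-bound : ∀ t p q → 1 ≤ p → t < q → 2 + t ≤ (q + p) + q
  rest-bound t p q 1≤p t<q = ≤-linear q (+-mono-≤ 1≤p t<q) (solve (t ∷ p ∷ q ∷ []))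

rest-shift : ∀ n t → 1 ≤ t → t < fib (2 + n) → letter (t + fib (3 + n)) ≡ letter t
rest-shift n t 1≤t t< = letter-shift (3 + n) t 1≤t (rest-bound t _ _ (1≤fib n) t<)

rest-shift-suc : ∀ n t → t < fib (2 + n) → letter (suc t + fib (3 + n)) ≡ letter (suc t)
rest-shift-suc n t t< = letter-shift (3 + n) (suc t) z<s
  (bound t _ _ (1≤fib n) (1≤fib (suc n)) t<)
  where
  bound : ∀ t p q → 1 ≤ p → 1 ≤ q → t < q → 3 + t ≤ (q + p) + q
  bound t p q 1≤p 1≤q t<q = ≤-linear 0 (+-mono-≤ 1≤p (+-mono-≤ 1≤q t<q)) (solve (t ∷ p ∷ q ∷ []))

-- Removing the largest Fibonacci number from x keeps the letters at x and x + 1, so a factor bb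
-- would move down to a smaller position. If x is itself a Fibonacci number, x + 1 carries the first
-- letter of the word, an a.
no-bb : ∀ x → IsB x → IsB (suc x) → ⊥
no-bb x = go x x ≤-refl
  where
  go : ∀ N x → x ≤ N → IsB x → IsB (suc x) → ⊥
  go zero zero _ () _
  go (suc N) x x≤N bx bsx with fib-decompose x (IsB⇒2≤ bx)
  ... | n , zero , t< , refl = a≢b (trans (sym (rest-shift-suc n 0 t<)) bsx)
  ... | n , suc t , t< , refl = go N (suc t) (bound t N _ x≤N (1≤fib (2 + n)))
          (trans (sym (rest-shift n (suc t) z<s t<)) bx)
          (trans (sym (rest-shift-suc n (suc t) t<)) bsx)
    where
    bound : ∀ t N f → suc t + f ≤ suc N → 1 ≤ f → suc t ≤ N
    bound t N f h 1≤f = ≤-linear 0 (+-mono-≤ h 1≤f) (solve (t ∷ N ∷ f ∷ []))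

-- Sums of two upper Wythoff numbers

IsSum : ℕ → Set
IsSum m = ∃₂ λ x y → IsB x × IsB y × x ≢ y × x + y ≡ m

-- The mirror image of x is z = y - 1, because x + z = F m - 1.
fib-not-sum : ∀ m x y → IsB x → IsB y → x + y ≡ fib m → ⊥
fib-not-sum m x zero _ ()
fib-not-sum m x (suc z) bx by eq = no-bb z (trans (sym (letter-mirror m x z (IsB⇒1≤ bx) (≤-pred (IsB⇒2≤ by))
  (trans (sym (+-suc x z)) eq))) bx) by

-- The mirror image of x is now y + 1.
fib-2-not-sum : ∀ m x y → IsB x → IsB y → 2 + (x + y) ≡ fib m → ⊥
fib-2-not-sum m x y bx by eq = no-bb y by (trans (sym (letter-mirror m x (suc y) (IsB⇒1≤ bx) z<s
  (trans (cong suc (+-suc x y)) eq))) bx)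

private
  -- Reducing the larger summand by F m turns a sum for 2 F m - d into one for F m - d.
  shift-larger : ∀ m d x z → IsB x → IsB (z + fib m) → 1 ≤ z → d + (x + (z + fib m)) ≡ fib m + fib m →
                 IsB z × d + (x + z) ≡ fib m
  shift-larger m d x z bx bz 1≤z eq =
    trans (sym (letter-shift m z 1≤z (≤-trans (bound d x z _ (IsB⇒2≤ bx) eq′) (fib≤fib-suc m)))) bz , eq′
    where
    cancel : ∀ d x z f → d + (x + (z + f)) ≡ f + f → d + (x + z) ≡ f
    cancel d x z f e = ≡-linear e (solve (d ∷ x ∷ z ∷ f ∷ []))
    bound : ∀ d x z f → 2 ≤ x → d + (x + z) ≡ f → 2 + z ≤ f
    bound d x z _ 2≤x refl = ≤-linear d 2≤x (solve (d ∷ x ∷ z ∷ []))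
    eq′ : d + (x + z) ≡ fib m
    eq′ = cancel d x z _ eq

  larger-bound₀ : ∀ x y f → x < y → x + y ≡ f + f → f < y
  larger-bound₀ x y f x<y eq with <-≤-connex f y
  ... | inj₁ f<y = f<y
  ... | inj₂ y≤f = ⊥-elim (<-irrefl eq (+-mono-<-≤ (<-≤-trans x<y y≤f) y≤f))

  double-fib-not-sum-< : ∀ m x y → IsB x → IsB y → x < y → x + y ≡ fib m + fib m → ⊥
  double-fib-not-sum-< m x y bx by x<y eq with z , refl ← <⇒∃ (larger-bound₀ x y (fib m) x<y eq)
    with bz , eq′ ← shift-larger m 0 x (suc z) bx by z<s eq = fib-not-sum m x (suc z) bx bz eq′

  -- With y < f and x < y the sum is at most 2 f - 3. Unlike in `larger-bound₀`, equality y = f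
  -- remains possible.
  larger-bound₂ : ∀ x y f → x < y → 2 + (x + y) ≡ f + f → f ≤ y
  larger-bound₂ x y f x<y eq with <-≤-connex y f
  ... | inj₂ f≤y = f≤y
  ... | inj₁ y<f = ⊥-elim (≤⇒⊥ 0 (+-mono-≤ (≤-trans (s≤s x<y) y<f) y<f) (≡-linear eq (solve (x ∷ y ∷ f ∷ []))))

  double-fib-2-not-sum-< : ∀ m x y → IsB x → IsB y → x < y → 2 + (x + y) ≡ fib m + fib m → ⊥
  double-fib-2-not-sum-< m x y bx by x<y eq with ≤⇒∃ (larger-bound₂ x y (fib m) x<y eq)
  ... | suc z , refl with bz , eq′ ← shift-larger m 2 x (suc z) bx by z<s eq =
    fib-2-not-sum m x (suc z) bx bz eq′
  -- Here y = F m and x = F m - 2, the mirror image of position 1, which carries a.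
  ... | zero , refl = a≢b (trans (sym (letter-mirror m x 1 (IsB⇒1≤ bx) ≤-refl (eq′ x _ eq))) bx)
    where
    eq′ : ∀ x f → 2 + (x + f) ≡ f + f → suc (x + 1) ≡ f
    eq′ x f e = ≡-linear e (solve (x ∷ f ∷ []))

double-fib-not-sum : ∀ m → ¬ IsSum (fib m + fib m)
double-fib-not-sum m (x , y , bx , by , x≢y , eq) with <-cmp x y
... | tri< x<y _ _ = double-fib-not-sum-< m x y bx by x<y eq
... | tri≈ _ x≡y _ = x≢y x≡y
... | tri> _ _ y<x = double-fib-not-sum-< m y x by bx y<x (trans (+-comm y x) eq)

double-fib-2-not-sum : ∀ m z → 2 + z ≡ fib m + fib m → ¬ IsSum z
double-fib-2-not-sum m z z≡ (x , y , bx , by , x≢y , refl) with <-cmp x y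
... | tri< x<y _ _ = double-fib-2-not-sum-< m x y bx by x<y z≡
... | tri≈ _ x≡y _ = x≢y x≡y
... | tri> _ _ y<x = double-fib-2-not-sum-< m y x by bx y<x (trans (cong (2 +_) (+-comm y x)) z≡)

private
  aa≢b : ∀ {x y} → letter x ≡ a → IsB y → x ≢ y
  aa≢b ax by refl = a≢b (trans (sym ax) by)

  IsAA⇒2≤ : ∀ {x} → 1 ≤ x → IsAA x → 2 ≤ x
  IsAA⇒2≤ {suc zero} _ (_ , ())
  IsAA⇒2≤ {suc (suc x)} _ _ = s≤s (s≤s z≤n)

  IsAA-rest : ∀ n t → 1 ≤ t → t < fib (2 + n) → IsAA (t + fib (3 + n)) → IsAA t
  IsAA-rest n t 1≤t t< (p , q) = trans (sym (rest-shift n t 1≤t t<)) p , trans (sym (rest-shift-suc n t t<)) q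

  IsB-rest : ∀ n t → 1 ≤ t → t < fib (2 + n) → IsB (t + fib (3 + n)) → IsB t
  IsB-rest n t 1≤t t< = trans (sym (rest-shift n t 1≤t t<))

-- If x is a sum then subtracting F m from a summand, or reflecting one in
-- F m, yields a smaller sum or a smaller difference, and vice versa.
private
  aa-not-sum′ : ∀ N x y z → x < N → IsAA x → IsB y → IsB z → y + z ≡ x → ⊥
  aa-not-diff : ∀ N t y w → y < N → 1 ≤ t → IsAA t → IsB y → IsB w → suc (w + t) ≡ y → ⊥

  aa-not-sum′ (suc N) x y z (s≤s x≤N) aax by bz eq
    with fib-decompose x (subst (2 ≤_) eq (≤-trans (IsB⇒2≤ by) (m≤m+n y z)))
  ... | n , zero , t< , refl = fib-not-sum (3 + n) y z by bz eq
  ... | n , t@(suc _) , t< , refl with aat ← IsAA-rest n t z<s t< aax | <-cmp y (fib (3 + n)) | <-cmp z (fib (3 + n))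
  ... | tri≈ _ refl _ | _ = aa≢b {t} {z} (proj₁ aat) bz (cancel t z _ eq)
    where
    cancel : ∀ t z f → f + z ≡ t + f → t ≡ z
    cancel t z f e = ≡-linear (sym e) (solve (t ∷ z ∷ f ∷ []))
  ... | _ | tri≈ _ refl _ = aa≢b {t} {y} (proj₁ aat) by (sym (+-cancelʳ-≡ (fib (3 + n)) y t eq))
  ... | tri> _ _ f<y | _ with y′ , refl ← <⇒∃ f<y = aa-not-sum′ N t (suc y′) z
        (≤-trans (+-mono-≤ (1≤fib (2 + n)) ≤-refl) (≤-trans (≤-reflexive (+-comm _ t)) x≤N)) aat
        (IsB-rest n (suc y′) z<s (≤-<-trans (bound _ z t y′+z≡t) t<) by) bz y′+z≡t
    where
    cancel : ∀ y z t f → y + f + z ≡ t + f → y + z ≡ t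
    cancel y z t f e = ≡-linear e (solve (y ∷ z ∷ t ∷ f ∷ []))
    bound : ∀ y z t → y + z ≡ t → y ≤ t
    bound y z _ refl = m≤m+n y z
    y′+z≡t : suc y′ + z ≡ t
    y′+z≡t = cancel (suc y′) z t _ eq
  ... | tri< _ _ _ | tri> _ _ f<z with z′ , refl ← <⇒∃ f<z = aa-not-sum′ N t y (suc z′)
        (≤-trans (+-mono-≤ (1≤fib (2 + n)) ≤-refl) (≤-trans (≤-reflexive (+-comm _ t)) x≤N)) aat
        by (IsB-rest n (suc z′) z<s (≤-<-trans (bound y _ t y+z′≡t) t<) bz) y+z′≡t
    where
    cancel : ∀ y z t f → y + (z + f) ≡ t + f → y + z ≡ t
    cancel y z t f e = ≡-linear e (solve (y ∷ z ∷ t ∷ f ∷ []))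
    bound : ∀ y z t → y + z ≡ t → z ≤ t
    bound y z _ refl = m≤n+m z y
    y+z′≡t : y + suc z′ ≡ t
    y+z′≡t = cancel y (suc z′) t _ eq
  ... | tri< y<f _ _ | tri< z<f _ _ with <⇒∃ z<f
  -- For z = F m - 1 the mirror image would be position 0, outside the word; but then y = t + 1 is
  -- the second a of the factor aa.
  ...   | zero , eqz = aa≢b {suc t} {y} (proj₂ aat) by (cancel y z t _ eqz eq)
    where
    cancel : ∀ y z t f → 1 + z ≡ f → y + z ≡ t + f → suc t ≡ y
    cancel y z t _ refl e = ≡-linear (sym e) (solve (y ∷ z ∷ t ∷ []))
  -- The mirror image F m - 1 - z of z carries b and lies t + 1 below y. The bound passes from x to
  -- y, and y < F m ≤ x.
  ...   | suc w , eqz = aa-not-diff N t y (suc w) (≤-trans y<f (≤-trans (m≤n+m _ t) x≤N)) z<s aat by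
          (trans (sym (letter-mirror (3 + n) z (suc w) (IsB⇒1≤ bz) z<s (trans (cong suc (+-comm z (suc w))) eqz))) bz)
          (cancel y z t w _ eqz eq)
    where
    cancel : ∀ y z t w f → 2 + w + z ≡ f → y + z ≡ t + f → suc (suc w + t) ≡ y
    cancel y z t w _ refl e = ≡-linear (sym e) (solve (y ∷ z ∷ t ∷ w ∷ []))

  aa-not-diff (suc N) t y w (s≤s y≤N) 1≤t aat by bw eq with fib-decompose y (IsB⇒2≤ by)
  -- Here y is a Fibonacci number, and w and t are mirror images of each other.
  ... | n , zero , y′< , refl = 
    a≢b (trans (sym (proj₁ aat)) (trans (sym (letter-mirror (3 + n) w t (IsB⇒1≤ bw) 1≤t eq)) bw))
  ... | n , y′@(suc _) , y′< , refl with by′ ← IsB-rest n y′ z<s y′< by | <-cmp w (fib (3 + n))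
  ... | tri≈ _ refl _ = aa≢b {suc t} {y′} (proj₂ aat) by′ (cancel t y′ _ eq)
    where
    cancel : ∀ t y f → suc (f + t) ≡ y + f → suc t ≡ y
    cancel t y f e = ≡-linear e (solve (t ∷ y ∷ f ∷ []))
  ... | tri> _ _ f<w with w′ , refl ← <⇒∃ f<w = aa-not-diff N t y′ (suc w′)
        (≤-trans (+-mono-≤ (1≤fib (2 + n)) ≤-refl) (≤-trans (≤-reflexive (+-comm _ y′)) y≤N)) 1≤t aat by′
        (IsB-rest n (suc w′) z<s (≤-<-trans (bound t y′ (suc w′) w′+t≡y′) y′<) bw) w′+t≡y′
    where
    cancel : ∀ t y w f → suc (w + f + t) ≡ y + f → suc (w + t) ≡ y
    cancel t y w f e = ≡-linear e (solve (t ∷ y ∷ w ∷ f ∷ []))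
    bound : ∀ t y w → suc (w + t) ≡ y → w ≤ y
    bound t _ w refl = ≤-trans (m≤m+n w t) (n≤1+n _)
    w′+t≡y′ : suc (suc w′ + t) ≡ y′
    w′+t≡y′ = cancel t y′ (suc w′) _ eq
  ... | tri< w<f _ _ with <⇒∃ w<f
  ...   | zero , eqw = aa≢b {t} {y′} (proj₁ aat) by′ (cancel t y′ w _ eqw eq)
    where
    cancel : ∀ t y w f → 1 + w ≡ f → suc (w + t) ≡ y + f → t ≡ y
    cancel t y w _ refl e = ≡-linear e (solve (t ∷ y ∷ w ∷ []))
  -- The mirror image F m - 1 - w of w and the remainder y′ are two positions of b with sum t, and t
  -- < y.
  ...   | suc v , eqw = aa-not-sum′ N t y′ (suc v) (≤-trans (bound t w _ eq) y≤N) aat by′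
          (trans (sym (letter-mirror (3 + n) w (suc v) (IsB⇒1≤ bw) z<s (trans (cong suc (+-comm w (suc v))) eqw))) bw)
          (cancel t y′ w v _ eqw eq)
    where
    bound : ∀ t w y → suc (w + t) ≡ y → suc t ≤ y
    bound t w _ refl = s≤s (m≤n+m t w)
    cancel : ∀ t y w v f → 2 + v + w ≡ f → suc (w + t) ≡ y + f → y + suc v ≡ t
    cancel t y w v _ refl e = ≡-linear (sym e) (solve (t ∷ y ∷ w ∷ v ∷ []))

aa-not-sum : ∀ x → IsAA x → ¬ IsSum x
aa-not-sum x aax (y , z , by , bz , _ , eq) = aa-not-sum′ (suc x) x y z ≤-refl aax by bz eq

-- Neighbourhoods of the Fibonacci numbers and of their doubles

IsBBefore : ℕ → Set
IsBBefore f = ∃ λ e → suc e ≡ f × IsB e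

private
  fib-b-step : ∀ n → IsB (fib (3 + n)) → IsB (fib (5 + n))
  fib-b-step n bf = trans (cong letter (+-comm (fib (4 + n)) (fib (3 + n))))
    (trans (letter-shift (4 + n) (fib (3 + n)) (IsB⇒1≤ bf) (+-monoˡ-≤ (fib (3 + n)) (2≤fib (suc n)))) bf)

  fib-b-before-step : ∀ n → IsBBefore (fib (3 + n)) → IsBBefore (fib (5 + n))
  fib-b-before-step n (e , eq , be) = e + fib (4 + n) , trans (cong (_+ fib (4 + n)) eq) (+-comm (fib (3 + n)) _) ,
    trans (letter-shift (4 + n) e (IsB⇒1≤ be) (bound e _ _ eq (2≤fib (suc n)))) be
    where
    bound : ∀ e p q → suc e ≡ p → 2 ≤ q → 2 + e ≤ q + p
    bound e _ q refl 2≤q = ≤-linear 1 2≤q (solve (e ∷ q ∷ []))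

-- Since F (m + 2) = F m + F (m + 1), the shift carries the b at F m or F m - 1 two indices further.
-- Thus b stands at F m for odd m (2, 5, 13) and at F m - 1 for even m (2, 7, 20); the alternative
-- records the parity of n.
fib-parity : ∀ n → (IsB (fib (3 + n)) × IsBBefore (fib (4 + n))) ⊎ (IsBBefore (fib (3 + n)) × IsB (fib (4 + n)))
fib-parity zero = inj₁ (refl , 2 , refl , refl)
fib-parity (suc n) with fib-parity n
... | inj₁ (odd , even) = inj₂ (even , fib-b-step n odd)
... | inj₂ (even , odd) = inj₁ (odd , fib-b-before-step n even)

-- Around a centre c, at distance less than L, the unsums repeat the
-- occurrences of aa at the beginning of the Fibonacci word.
record Center (c L : ℕ) : Set where
  field
    not-sum : ¬ IsSum c
    before  : ∀ z → suc z ≡ c → IsSum z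
    aa      : ∀ t → 1 ≤ t → 3 + t ≤ L → IsAA t → ¬ IsSum (t + c)
    at-b    : ∀ t → 3 + t ≤ L → IsB t → IsSum (t + c)
    next-b  : ∀ t → 3 + t ≤ L → IsB (suc t) → IsSum (t + c)
    end     : ∀ z → 2 + z ≡ L + c → ¬ IsSum z

-- The next centre is F (i + 7) + F (i + 4) = 2 F (i + 6). The summands come from F (i + 7) = F (i +
-- 6) + F (i + 5), or from F (i + 7) alone: one of them is a Fibonacci number, or its predecessor,
-- carrying b by parity, and the other absorbs t.
fib-center : ∀ i → Center (fib (7 + i)) (fib (4 + i))
fib-center i = record
  { not-sum = λ (x , y , bx , by , _ , eq) → fib-not-sum (7 + i) x y bx by eq
  ; before  = before
  ; aa      = λ t 1≤t t≤ aat → aa-not-sum _ (IsAA-shift (7 + i) t 1≤t (bound₈ t F₃ F₄ t≤) aat)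
  ; at-b    = at-b
  ; next-b  = next-b
  ; end     = λ z eq → double-fib-2-not-sum (6 + i) z (trans eq (arrange (fib (3 + i)) (fib (4 + i))))
  }
  where
  F₃ F₄ F₅ F₆ F₇ : ℕ
  F₃ = fib (3 + i)
  F₄ = fib (4 + i)
  F₅ = fib (5 + i)
  F₆ = fib (6 + i)
  F₇ = fib (7 + i)

  arrange : ∀ p q → q + (q + p + q + (q + p)) ≡ (q + p + q) + (q + p + q)
  arrange p q = solve (p ∷ q ∷ [])

  bound₈ : ∀ t p q → 3 + t ≤ q → 3 + t ≤ (q + p + q + (q + p)) + (q + p + q)
  bound₈ t p q h = ≤-linear (p + p + p + q + q + q + q) h (solve (t ∷ p ∷ q ∷ []))

  bound₆ : ∀ t p q → 3 + t ≤ q → 2 + suc t ≤ q + p + q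
  bound₆ t p q h = ≤-linear (p + q) h (solve (t ∷ p ∷ q ∷ []))

  lift : ∀ t → 3 + t ≤ F₄ → letter (suc t + F₅) ≡ letter (suc t)
  lift t t≤ = letter-shift (5 + i) (suc t) z<s (bound₆ t F₃ F₄ t≤)

  before : ∀ z → suc z ≡ F₇ → IsSum z
  before z eq with fib-parity (2 + i)
  ... | inj₁ (odd , e , eq₆ , be) = F₅ , e , odd , be , distinct e F₃ F₄ eq₆ (3≤fib i) , total e z F₃ F₄ eq₆ eq
    where
    distinct : ∀ e p q → suc e ≡ q + p + q → 3 ≤ q → q + p ≢ e
    distinct _ p q e≡ 3≤q refl = ≤⇒⊥ 1 3≤q (≡-linear e≡ (solve (p ∷ q ∷ [])))
    total : ∀ e z p q → suc e ≡ q + p + q → suc z ≡ q + p + q + (q + p) → q + p + e ≡ z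
    total e z p q h₁ h₂ = ≡-linear (cong₂ _+_ h₁ (sym h₂)) (solve (e ∷ z ∷ p ∷ q ∷ []))
  ... | inj₂ ((e , eq₅ , be) , odd) = F₆ , e , odd , be , distinct e F₃ F₄ eq₅ , total e z F₃ F₄ eq₅ eq
    where
    distinct : ∀ e p q → suc e ≡ q + p → q + p + q ≢ e
    distinct _ p q e≡ refl = ≤⇒⊥ q (≤-reflexive e≡) (solve (p ∷ q ∷ []))
    total : ∀ e z p q → suc e ≡ q + p → suc z ≡ q + p + q + (q + p) → q + p + q + e ≡ z
    total e z p q h₁ h₂ = ≡-linear (cong₂ _+_ h₁ (sym h₂)) (solve (e ∷ z ∷ p ∷ q ∷ []))

  at-b : ∀ t → 3 + t ≤ F₄ → IsB t → IsSum (t + F₇)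
  at-b zero _ ()
  at-b t@(suc t′) t≤ bt with fib-parity (3 + i)
  ... | inj₁ (odd , _) = F₆ , t + F₅ , odd , trans (lift t′ (≤-trans (n≤1+n _) t≤)) bt , distinct t F₃ F₄ t≤ , total t F₃ F₄
    where
    distinct : ∀ t p q → 3 + t ≤ q → q + p + q ≢ t + (q + p)
    distinct t p q h e = ≤⇒⊥ 2 h (≡-linear (sym e) (solve (t ∷ p ∷ q ∷ [])))
    total : ∀ t p q → q + p + q + (t + (q + p)) ≡ t + (q + p + q + (q + p))
    total t p q = solve (t ∷ p ∷ q ∷ [])
  ... | inj₂ (_ , odd) = F₇ , t , odd , bt , distinct t F₃ F₄ t≤ , +-comm F₇ t
    where
    distinct : ∀ t p q → 3 + t ≤ q → q + p + q + (q + p) ≢ t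
    distinct _ p q h refl = ≤⇒⊥ (2 + (p + p + q + q)) h (solve (p ∷ q ∷ []))

  next-b : ∀ t → 3 + t ≤ F₄ → IsB (suc t) → IsSum (t + F₇)
  next-b t t≤ bt with fib-parity (3 + i)
  ... | inj₁ (_ , e , eq₇ , be) = e , suc t , be , bt , distinct e t F₃ F₄ t≤ eq₇ , total e t F₃ F₄ eq₇
    where
    distinct : ∀ e t p q → 3 + t ≤ q → suc e ≡ q + p + q + (q + p) → e ≢ suc t
    distinct _ t p q h e refl = ≤⇒⊥ (p + p + q + q) h (≡-linear e (solve (t ∷ p ∷ q ∷ [])))
    total : ∀ e t p q → suc e ≡ q + p + q + (q + p) → e + suc t ≡ t + (q + p + q + (q + p))
    total e t p q h = ≡-linear h (solve (e ∷ t ∷ p ∷ q ∷ []))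
  ... | inj₂ ((e , eq₆ , be) , _) = e , suc t + F₅ , be , trans (lift t t≤) bt , distinct e t F₃ F₄ t≤ eq₆ , total e t F₃ F₄ eq₆
    where
    distinct : ∀ e t p q → 3 + t ≤ q → suc e ≡ q + p + q → e ≢ suc t + (q + p)
    distinct _ t p q h e refl = ≤⇒⊥ 0 h (≡-linear e (solve (t ∷ p ∷ q ∷ [])))
    total : ∀ e t p q → suc e ≡ q + p + q → e + (suc t + (q + p)) ≡ t + (q + p + q + (q + p))
    total e t p q h = ≡-linear h (solve (e ∷ t ∷ p ∷ q ∷ []))

-- The next centre is 2 F (i + 5) + F (i + 4) = F (i + 7). The centre splits as F (i + 5) + F (i +
-- 5) or as F (i + 6) + F (i + 3); parity selects the split, and the second one also carries aa from
-- t to t + c by two shifts.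
double-fib-center : ∀ i → Center (fib (5 + i) + fib (5 + i)) (fib (4 + i))
double-fib-center i = record
  { not-sum = double-fib-not-sum (5 + i)
  ; before  = before
  ; aa      = λ t 1≤t t≤ aat → aa-not-sum _ (subst IsAA (arrange t F₃ F₄)
      (IsAA-shift (6 + i) (t + F₃) (≤-trans 1≤t (m≤m+n t F₃)) (bound₇ t F₃ F₄ t≤) (IsAA-shift (3 + i) t 1≤t t≤ aat)))
  ; at-b    = at-b
  ; next-b  = next-b
  ; end     = λ z eq (x , y , bx , by , _ , eq′) →
      fib-2-not-sum (7 + i) x y bx by (trans (cong (2 +_) eq′) (trans eq (end-arrange (fib (3 + i)) (fib (4 + i)))))
  }
  where
  F₃ F₄ F₅ F₆ : ℕ
  F₃ = fib (3 + i)
  F₄ = fib (4 + i)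
  F₅ = fib (5 + i)
  F₆ = fib (6 + i)

  arrange : ∀ t p q → t + p + (q + p + q) ≡ t + ((q + p) + (q + p))
  arrange t p q = solve (t ∷ p ∷ q ∷ [])

  end-arrange : ∀ p q → q + ((q + p) + (q + p)) ≡ q + p + q + (q + p)
  end-arrange p q = solve (p ∷ q ∷ [])

  bound₇ : ∀ t p q → 3 + t ≤ q → 3 + (t + p) ≤ q + p + q + (q + p)
  bound₇ t p q h = ≤-linear (p + q + q) h (solve (t ∷ p ∷ q ∷ []))

  bound₆ : ∀ t p q → 3 + t ≤ q → 2 + suc t ≤ q + p + q
  bound₆ t p q h = ≤-linear (p + q) h (solve (t ∷ p ∷ q ∷ []))

  lift₅ : ∀ t → 3 + t ≤ F₄ → letter (suc t + F₅) ≡ letter (suc t)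
  lift₅ t t≤ = letter-shift (5 + i) (suc t) z<s (bound₆ t F₃ F₄ t≤)

  lift₃ : ∀ t → 3 + t ≤ F₄ → letter (suc t + F₃) ≡ letter (suc t)
  lift₃ t t≤ = letter-shift (3 + i) (suc t) z<s t≤

  before : ∀ z → suc z ≡ F₅ + F₅ → IsSum z
  before z eq with fib-parity i
  ... | inj₁ (odd , even) with e , eq₆ , be ← fib-b-before-step (suc i) even =
    F₃ , e , odd , be , distinct e F₃ F₄ eq₆ (3≤fib i) , total e z F₃ F₄ eq₆ eq
    where
    distinct : ∀ e p q → suc e ≡ q + p + q → 3 ≤ q → p ≢ e
    distinct _ p q e≡ 3≤q refl = ≤⇒⊥ (1 + q) 3≤q (≡-linear e≡ (solve (p ∷ q ∷ [])))
    total : ∀ e z p q → suc e ≡ q + p + q → suc z ≡ (q + p) + (q + p) → p + e ≡ z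
    total e z p q h₁ h₂ = ≡-linear (cong₂ _+_ h₁ (sym h₂)) (solve (e ∷ z ∷ p ∷ q ∷ []))
  ... | inj₂ ((e , eq₃ , be) , odd) =
    F₆ , e , fib-b-step (suc i) odd , be , distinct e F₃ F₄ eq₃ , total e z F₃ F₄ eq₃ eq
    where
    distinct : ∀ e p q → suc e ≡ p → q + p + q ≢ e
    distinct _ p q e≡ refl = ≤⇒⊥ (q + q) (≤-reflexive e≡) (solve (p ∷ q ∷ []))
    total : ∀ e z p q → suc e ≡ p → suc z ≡ (q + p) + (q + p) → q + p + q + e ≡ z
    total e z p q h₁ h₂ = ≡-linear (cong₂ _+_ h₁ (sym h₂)) (solve (e ∷ z ∷ p ∷ q ∷ []))

  at-b : ∀ t → 3 + t ≤ F₄ → IsB t → IsSum (t + (F₅ + F₅))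
  at-b zero _ ()
  at-b t@(suc t′) t≤ bt with fib-parity (2 + i)
  ... | inj₁ (odd , _) = F₅ , t + F₅ , odd , trans (lift₅ t′ (≤-trans (n≤1+n _) t≤)) bt , distinct t′ F₅ , total t F₅
    where
    distinct : ∀ t f → f ≢ suc t + f
    distinct t f e = ≤⇒⊥ t (≤-reflexive (sym e)) (+-comm (suc t) f)
    total : ∀ t f → f + (t + f) ≡ t + (f + f)
    total t f = solve (t ∷ f ∷ [])
  ... | inj₂ (_ , odd) = F₆ , t + F₃ , odd , trans (lift₃ t′ (≤-trans (n≤1+n _) t≤)) bt , distinct t F₃ F₄ t≤ , total t F₃ F₄
    where
    distinct : ∀ t p q → 3 + t ≤ q → q + p + q ≢ t + p
    distinct t p q h e = ≤⇒⊥ (2 + q) h (≡-linear (sym e) (solve (t ∷ p ∷ q ∷ [])))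
    total : ∀ t p q → q + p + q + (t + p) ≡ t + ((q + p) + (q + p))
    total t p q = solve (t ∷ p ∷ q ∷ [])

  next-b : ∀ t → 3 + t ≤ F₄ → IsB (suc t) → IsSum (t + (F₅ + F₅))
  next-b t t≤ bt with fib-parity (2 + i)
  ... | inj₁ (_ , e , eq₆ , be) = e , suc t + F₃ , be , trans (lift₃ t t≤) bt , distinct e t F₃ F₄ t≤ eq₆ , total e t F₃ F₄ eq₆
    where
    distinct : ∀ e t p q → 3 + t ≤ q → suc e ≡ q + p + q → e ≢ suc t + p
    distinct _ t p q h e refl = ≤⇒⊥ q h (≡-linear e (solve (t ∷ p ∷ q ∷ [])))
    total : ∀ e t p q → suc e ≡ q + p + q → e + (suc t + p) ≡ t + ((q + p) + (q + p))
    total e t p q h = ≡-linear h (solve (e ∷ t ∷ p ∷ q ∷ []))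
  ... | inj₂ ((e , eq₅ , be) , _) = e , suc t + F₅ , be , trans (lift₅ t t≤) bt , distinct e t F₅ eq₅ , total e t F₅ eq₅
    where
    distinct : ∀ e t f → suc e ≡ f → e ≢ suc t + f
    distinct e t _ refl e≡ = ≤⇒⊥ (suc t) (≤-reflexive (sym e≡)) (solve (e ∷ t ∷ []))
    total : ∀ e t f → suc e ≡ f → e + (suc t + f) ≡ t + (f + f)
    total e t _ refl = solve (e ∷ t ∷ [])

-- The positions of aa

-- The occurrences of aa start at the positions `3 + σ n`: 3, 8, 11 and so on.
σ : ℕ → ℕ
σ n = ListAction.sum (applyUpTo fibWord′ n)

sum-applyUpTo-+ : ∀ (f : ℕ → ℕ) m n →
                  ListAction.sum (applyUpTo f (m + n)) ≡ ListAction.sum (applyUpTo f m) + ListAction.sum (applyUpTo (λ i → f (m + i)) n)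
sum-applyUpTo-+ f m n = trans (cong ListAction.sum (applyUpTo-+ f m n)) (sum-++ (applyUpTo f m) _)

σ-suc : ∀ n → σ (suc n) ≡ fibWord′ n + σ n
σ-suc n = begin
  σ (suc n)                      ≡⟨ cong σ (+-comm 1 n) ⟩
  σ (n + 1)                      ≡⟨ sum-applyUpTo-+ fibWord′ n 1 ⟩
  σ n + (fibWord′ (n + 0) + 0)   ≡⟨ cong (σ n +_) (trans (+-identityʳ _) (cong fibWord′ (+-identityʳ n))) ⟩
  σ n + fibWord′ n               ≡⟨ +-comm (σ n) _ ⟩
  fibWord′ n + σ n               ∎
  where open ≡-Reasoning

σ-mono : ∀ {m n} → m ≤ n → σ m ≤ σ n
σ-mono {m} m≤n with k , refl ← ≤⇒∃ m≤n =
  ≤-trans (m≤m+n (σ m) _) (≤-reflexive (trans (sym (sum-applyUpTo-+ fibWord′ m k)) (cong σ (+-comm m k))))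

σ-repeats : ∀ n t → t ≤ fib (2 + n) → σ (t + fib (3 + n)) ≡ σ t + σ (fib (3 + n))
σ-repeats n t t≤ = begin
  σ (t + f)                                            ≡⟨ cong σ (+-comm t f) ⟩
  σ (f + t)                                            ≡⟨ sum-applyUpTo-+ fibWord′ f t ⟩
  σ f + ListAction.sum (applyUpTo (λ i → fibWord′ (f + i)) t)     ≡⟨ cong (λ w → σ f + ListAction.sum w) (applyUpTo-cong t λ i i<t →
    cong digit (trans (cong fibWord (+-comm f i)) (fibWord-repeats n i (<-≤-trans i<t t≤)))) ⟩
  σ f + σ t                                            ≡⟨ +-comm (σ f) (σ t) ⟩
  σ t + σ f                                            ∎
  where
  open ≡-Reasoning
  f = fib (3 + n)

-- The digits 5 and 3 are the lengths of φ³(a) and φ³(b), so the digit sum over φⁿ(a) is the length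
-- of φⁿ⁺³(a). The proof uses the Fibonacci recursion that both sides satisfy.
σ-fib : ∀ n → σ (fib (2 + n)) ≡ fib (5 + n)
σ-fib zero          = refl
σ-fib (suc zero)    = refl
σ-fib (suc (suc n)) = begin
  σ (fib (3 + n) + fib (2 + n))       ≡⟨ cong σ (+-comm (fib (3 + n)) _) ⟩
  σ (fib (2 + n) + fib (3 + n))       ≡⟨ σ-repeats n (fib (2 + n)) ≤-refl ⟩
  σ (fib (2 + n)) + σ (fib (3 + n))   ≡⟨ cong₂ _+_ (σ-fib n) (σ-fib (suc n)) ⟩
  fib (5 + n) + fib (6 + n)           ≡⟨ +-comm (fib (5 + n)) _ ⟩
  fib (7 + n)                         ∎
  where open ≡-Reasoning

-- The last two letters of a prefix of Fibonacci length at least 2 are a and b in some order, worth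
-- 8. In the step, F (n + 5) - 2 = (F (n + 3) - 2) + F (n + 4) reduces the claim by two indices.
σ-fib-2 : ∀ n N → 2 + N ≡ fib (3 + n) → 8 + σ N ≡ fib (6 + n)
σ-fib-2 zero       N refl = refl
σ-fib-2 (suc zero) N refl = refl
σ-fib-2 (suc (suc n)) N eq with M , eq′ ← ≤⇒∃ (2≤fib n) = begin
  8 + σ N                             ≡⟨ cong (λ k → 8 + σ k) (N≡ N M _ _ eq eq′) ⟩
  8 + σ (M + fib (4 + n))             ≡⟨ cong (8 +_) (σ-repeats (1 + n) M (subst (M ≤_) eq′ (m≤m+n M 2))) ⟩
  8 + σ M + σ (fib (4 + n))           ≡⟨ cong₂ _+_ (σ-fib-2 n M (trans (+-comm 2 M) eq′)) (σ-fib (2 + n)) ⟩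
  fib (6 + n) + fib (7 + n)           ≡⟨ +-comm (fib (6 + n)) _ ⟩
  fib (8 + n)                         ∎
  where
  open ≡-Reasoning
  N≡ : ∀ N M p q → 2 + N ≡ q + p → M + 2 ≡ p → N ≡ M + q
  N≡ N M _ q e refl = ≡-linear e (solve (N ∷ M ∷ q ∷ []))

-- The word is made of the blocks φ³(a) = abaab and φ³(b) = aba. In each of
-- them, with the a that follows it, the only aa starts at the third letter;
-- Block d r says that this aa at r is followed by one at digit d + r.
Block : Letter → ℕ → Set
Block a r = IsB (2 + r) × IsB (4 + r) × IsAA (5 + r)
Block b r = IsB (2 + r) × IsAA (3 + r)

Block-shift : ∀ d m r → 8 + r ≤ fib (suc m) → Block d r → Block d (r + fib m)
Block-shift a m r r≤ (b₂ , b₄ , aa₅) =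
  trans (letter-shift m (2 + r) z<s (≤-trans (m≤n+m _ 4) r≤)) b₂ ,
  trans (letter-shift m (4 + r) z<s (≤-trans (m≤n+m _ 2) r≤)) b₄ ,
  IsAA-shift m (5 + r) z<s r≤ aa₅
Block-shift b m r r≤ (b₂ , aa₃) =
  trans (letter-shift m (2 + r) z<s (≤-trans (m≤n+m _ 4) r≤)) b₂ ,
  IsAA-shift m (3 + r) z<s (≤-trans (m≤n+m _ 2) r≤) aa₃

-- Shifting the index t by F (k + 4) moves the position `3 + σ t` by σ (F (k + 4)) = F (k + 7),
-- again a Fibonacci number, so a block is carried along by the shift of letters.
fibWord-blocks : ∀ n → Block (fibWord n) (3 + σ n)
fibWord-blocks n = go n n ≤-refl
  where
  go : ∀ N n → n ≤ N → Block (fibWord n) (3 + σ n)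
  go _ zero          _ = refl , refl , refl , refl
  go _ (suc zero)    _ = refl , refl , refl
  go (suc N) n@(suc (suc _)) n≤N with fib-decompose n (s≤s (s≤s z≤n))
  -- This is n = 2, checked by evaluation.
  ... | zero , zero , _ , eq = subst (λ k → Block (fibWord k) (3 + σ k)) eq (refl , refl , refl , refl)
  ... | zero , suc t , s≤s () , _
  ... | suc k , t , t< , eq = subst (λ k → Block (fibWord k) (3 + σ k)) eq
    (subst (λ d → Block d (3 + σ (t + fib (4 + k)))) (sym (fibWord-repeats (1 + k) t t<))
      (subst (λ s → Block (fibWord t) (3 + s)) (sym σ≡)
        (Block-shift (fibWord t) (7 + k) (3 + σ t) (bound _ _ _ σt≤ (5≤fib k) (3≤fib k))
          (go N t (≤-pred (≤-trans (t<n t _ n (1≤fib (3 + k)) eq) n≤N))))))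
    where
    t<n : ∀ t f n → 1 ≤ f → t + f ≡ n → t < n
    t<n t f _ 1≤f refl = ≤-linear 0 1≤f (solve (t ∷ f ∷ []))
    σ≡ : σ (t + fib (4 + k)) ≡ σ t + fib (7 + k)
    σ≡ = trans (σ-repeats (1 + k) t (<⇒≤ t<)) (cong (σ t +_) (σ-fib (2 + k)))
    σt≤ : σ t ≤ fib (6 + k)
    σt≤ = ≤-trans (σ-mono (<⇒≤ t<)) (≤-reflexive (σ-fib (1 + k)))
    bound : ∀ s f g → s ≤ f + g → 5 ≤ f → 3 ≤ g → 8 + (3 + s) ≤ (f + g + f) + (f + g)
    bound s f g h₁ h₂ h₃ = ≤-linear 2 (+-mono-≤ h₁ (+-mono-≤ h₂ (+-mono-≤ h₂ h₃))) (solve (s ∷ f ∷ g ∷ []))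

-- Unsums

IsB⇒UpperWythoff : ∀ {x} → IsB x → UpperWythoff x
IsB⇒UpperWythoff {suc k} bx = k , refl , bx

UpperWythoff⇒IsB : ∀ {x} → UpperWythoff x → IsB x
UpperWythoff⇒IsB (k , refl , bk) = bk

¬IsSum⇒Unsum : ∀ {m} → 0 < m → ¬ IsSum m → Unsum m
¬IsSum⇒Unsum 0<m ¬s = 0<m , λ (x , y , ux , uy , x≢y , m≡) →
  ¬s (x , y , UpperWythoff⇒IsB ux , UpperWythoff⇒IsB uy , x≢y , sym m≡)

IsSum⇒¬Unsum : ∀ {m} → IsSum m → ¬ Unsum m
IsSum⇒¬Unsum (x , y , bx , by , x≢y , eq) (_ , ¬s) =
  ¬s (x , y , IsB⇒UpperWythoff bx , IsB⇒UpperWythoff by , x≢y , sym eq)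

isB? : Decidable IsB
isB? x with letter x
... | a = no λ ()
... | b = yes refl

isSum? : Decidable IsSum
isSum? m = map′ to from (anyUpTo? (λ x → isB? x ×-dec isB? (m ∸ x) ×-dec ¬? (x ≟ m ∸ x)) (suc m))
  where
  to : (∃ λ x → x < suc m × IsB x × IsB (m ∸ x) × x ≢ m ∸ x) → IsSum m
  to (x , s≤s x≤m , bx , by , x≢y) = x , m ∸ x , bx , by , x≢y , m+[n∸m]≡n x≤m
  from : IsSum m → ∃ λ x → x < suc m × IsB x × IsB (m ∸ x) × x ≢ m ∸ x
  from (x , y , bx , by , x≢y , refl) =
    x , s≤s (m≤m+n x y) , bx , subst IsB (sym (m+n∸m≡n x y)) by , x≢y ∘ (λ eq → trans eq (m+n∸m≡n x y))

unsum? : Decidable Unsum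
unsum? zero = no λ ()
unsum? m@(suc _) with isSum? m
... | yes s = no (IsSum⇒¬Unsum s)
... | no ¬s = yes (¬IsSum⇒Unsum z<s ¬s)

-- Increasing enumerations

Next : (ℕ → Set) → ℕ → ℕ → Set
Next P x d = 0 < d × P (d + x) × (∀ e → suc e < d → ¬ P (suc e + x))

-- A certificate for a run of consecutive gaps that mentions no enumeration, so that runs can be
-- built block by block and joined.
data Walk (P : ℕ → Set) : ℕ → List ℕ → ℕ → Set where
  []  : ∀ {x} → Walk P x [] x
  _∷_ : ∀ {x d w y} → Next P x d → Walk P (d + x) w y → Walk P x (d ∷ w) y

_++ʷ_ : ∀ {P x y z w v} → Walk P x w y → Walk P y v z → Walk P x (w ++ v) z
[]       ++ʷ q = q
(n ∷ p)  ++ʷ q = n ∷ (p ++ʷ q)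

walk-applyUpTo : ∀ {P} (pos g : ℕ → ℕ) n → (∀ k → k < n → Next P (pos k) (g k)) →
                 (∀ k → pos (suc k) ≡ g k + pos k) → Walk P (pos 0) (applyUpTo g n) (pos n)
walk-applyUpTo pos g zero    next step = []
walk-applyUpTo {P} pos g (suc n) next step = next 0 z<s ∷
  subst (λ x → Walk P x (applyUpTo (g ∘ suc) n) (pos (suc n))) (step 0)
    (walk-applyUpTo (pos ∘ suc) (g ∘ suc) n (λ k k<n → next (suc k) (s<s k<n)) (step ∘ suc))

module _ {P : ℕ → Set} {u : ℕ → ℕ} (enum : IsIncreasingEnumeration P u) where

  private
    increasing : ∀ {i j} → i < j → u i < u j
    increasing = proj₁ enum

    holds : ∀ k → P (u k)
    holds k = Equivalence.from (proj₂ enum (u k)) (k , refl)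

    monotone : ∀ {i j} → i ≤ j → u i ≤ u j
    monotone i≤j with m≤n⇒m<n∨m≡n i≤j
    ... | inj₁ i<j  = <⇒≤ (increasing i<j)
    ... | inj₂ refl = ≤-refl

    reflects-< : ∀ {i j} → u i < u j → i < j
    reflects-< {i} {j} ui<uj with <-≤-connex i j
    ... | inj₁ i<j = i<j
    ... | inj₂ j≤i = ⊥-elim (<⇒≱ ui<uj (monotone j≤i))

  next-element : ∀ k d → Next P (u k) d → u (suc k) ≡ d + u k
  next-element k d (0<d , pd , gap) with j , uj≡ ← Equivalence.to (proj₂ enum (d + u k)) pd
    with m≤n⇒m<n∨m≡n (≤-trans (monotone (reflects-< (subst (u k <_) (sym uj≡) (+-monoˡ-≤ (u k) 0<d)))) (≤-reflexive uj≡))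
  ... | inj₂ eq = eq
  ... | inj₁ u< with e , eq ← <⇒∃ (increasing (n<1+n k)) =
    ⊥-elim (gap e (+-cancelʳ-< (u k) (suc e) d (subst (_< d + u k) (sym eq) u<)) (subst P (sym eq) (holds (suc k))))

  first-element : P 1 → (∀ m → P m → 0 < m) → u 0 ≡ 1
  first-element p1 pos with j , uj≡ ← Equivalence.to (proj₂ enum 1) p1 =
    ≤-antisym (≤-trans (monotone z≤n) (≤-reflexive uj≡)) (pos (u 0) (holds 0))

  -- The function `g` is the gap sequence from index k on, given only pointwise because `applyUpTo`
  -- recurses on `g ∘ suc`.
  walk-gaps : ∀ {w y} k (g : ℕ → ℕ) → (∀ i → g i ≡ gaps u (i + k)) → Walk P (u k) w y →
              applyUpTo g (length w) ≡ w
  walk-gaps k g g≗ [] = refl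
  walk-gaps {d ∷ w} {y} k g g≗ (n ∷ p) = cong₂ _∷_
    (trans (g≗ 0) (trans (cong (_∸ u k) (next-element k d n)) (m+n∸n≡m d (u k))))
    (walk-gaps (suc k) (g ∘ suc) (λ i → trans (g≗ (suc i)) (cong (gaps u) (sym (+-suc i k))))
      (subst (λ x → Walk P x w y) (sym (next-element k d n)) p))

module _ {P : ℕ → Set} (P? : Decidable P) where

  find-next : ∀ n x → P (suc n + x) → ∃ λ d → Next P x d
  find-next n x p with P? (suc x)
  ... | yes p₁ = 1 , z<s , p₁ , λ { _ (s≤s ()) }
  find-next zero    x p | no ¬p₁ = ⊥-elim (¬p₁ p)
  find-next (suc n) x p | no ¬p₁
    with d , 0<d , pd , gap ← find-next n (suc x) (subst P (sym (+-suc (suc n) x)) p) =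
    suc d , z<s , subst P (+-suc d x) pd ,
    λ { zero    _         → ¬p₁
      ; (suc e) (s≤s e<d) → gap e e<d ∘ subst P (sym (+-suc (suc e) x)) }

  enumeration-exists : P 1 → (∀ m → P m → 0 < m) → (∀ x → ∃ λ n → P (suc n + x)) →
                       ∃ (IsIncreasingEnumeration P)
  enumeration-exists p1 pos unbounded = u , increasing , λ m → mk⇔ (complete m) λ { (k , refl) → holds k }
    where
    step : ∀ x → ∃ λ d → Next P x d
    step x = find-next (proj₁ (unbounded x)) x (proj₂ (unbounded x))

    u : ℕ → ℕ
    u zero    = 1
    u (suc k) = proj₁ (step (u k)) + u k

    u-suc : ∀ k → u k < u (suc k)
    u-suc k = +-monoˡ-≤ (u k) (proj₁ (proj₂ (step (u k))))

    holds : ∀ k → P (u k)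
    holds zero    = p1
    holds (suc k) = proj₁ (proj₂ (proj₂ (step (u k))))

    increasing : ∀ {i j} → i < j → u i < u j
    increasing {i} {suc j} (s≤s i≤j) with m≤n⇒m<n∨m≡n i≤j
    ... | inj₁ i<j  = <-trans (increasing i<j) (u-suc j)
    ... | inj₂ refl = u-suc j

    -- Every positive number lies between two consecutive values of `u`; an element strictly between
    -- them would contradict the choice of the step.
    interval : ∀ m → ∃ λ k → u k ≤ suc m × suc m < u (suc k)
    interval zero = 0 , ≤-refl , u-suc 0
    interval (suc m) with k , lo , hi ← interval m with m≤n⇒m<n∨m≡n hi
    ... | inj₁ hi′ = k , m≤n⇒m≤1+n lo , hi′
    ... | inj₂ eq  = suc k , ≤-reflexive (sym eq) , ≤-<-trans (≤-reflexive eq) (u-suc (suc k))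

    complete : ∀ m → P m → ∃ λ k → u k ≡ m
    complete zero p with () ← pos 0 p
    complete (suc m) p with k , lo , hi ← interval m with m≤n⇒m<n∨m≡n lo
    ... | inj₂ eq = k , eq
    ... | inj₁ lo′ with e , eq ← <⇒∃ lo′ = ⊥-elim (proj₂ (proj₂ (proj₂ (step (u k)))) e
          (+-cancelʳ-< (u k) (suc e) _ (≤-<-trans (≤-reflexive eq) hi)) (subst P (sym eq) p))

-- The words W

-- The first 3 leads from a centre c to the first aa at c + 3, the middle runs through the further
-- aa's, and the last 3 leads to the unsum two below the next centre. In `W 1` that unsum is already
-- c + 3, so a single 3 remains.
W : ℕ → List ℕ
W 0             = []
W 1             = 3 ∷ []
W (suc (suc i)) = 3 ∷ applyUpTo fibWord′ (fib (3 + i) ∸ 2) ++ [ 3 ]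

fib∸2 : ∀ i → 2 + (fib (3 + i) ∸ 2) ≡ fib (3 + i)
fib∸2 i = m+[n∸m]≡n (2≤fib i)

-- A block starts two below its centre: the gap 2 leads to c, because c - 1 is a sum, and
-- `W (suc i)` then leads to the point two below the next centre.
block-walk : ∀ {c} i x → 2 + x ≡ c → Center c (fib (5 + i)) →
             ∃ λ y → 2 + y ≡ fib (5 + i) + c × Walk Unsum x (2 ∷ W (suc i)) y
block-walk i x refl center = walk i center
  where
  c : ℕ
  c = 2 + x

  module _ {L} (center : Center c L) where

    open Center center

    enter : Next Unsum x 2
    enter = z<s , ¬IsSum⇒Unsum z<s not-sum , λ
      { zero    _             → IsSum⇒¬Unsum (before (suc x) refl)
      ; (suc e) (s≤s (s≤s ())) }

    -- The b at r + 2 excludes both intermediate numbers, as `next-b` for r + 1 and as `at-b` for r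
    -- + 2.
    three : ∀ r → 5 + r ≤ L → IsB (2 + r) → Unsum (3 + (r + c)) → Next Unsum (r + c) 3
    three r r≤ b₂ u₃ = z<s , u₃ , λ
      { zero          _ → IsSum⇒¬Unsum (next-b (1 + r) (≤-trans (n≤1+n _) r≤) b₂)
      ; (suc zero)    _ → IsSum⇒¬Unsum (at-b (2 + r) r≤ b₂)
      ; (suc (suc e)) (s≤s (s≤s (s≤s ()))) }

    block : ∀ d r → 3 + (digit d + r) ≤ L → Block d r → Next Unsum (r + c) (digit d)
    block a r r≤ (b₂ , b₄ , aa₅) = z<s , ¬IsSum⇒Unsum z<s (aa (5 + r) z<s r≤ aa₅) , λ
      { zero                      _ → IsSum⇒¬Unsum (next-b (1 + r) (≤-trans (m≤n+m _ 4) r≤) b₂)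
      ; (suc zero)                _ → IsSum⇒¬Unsum (at-b (2 + r) (≤-trans (m≤n+m _ 3) r≤) b₂)
      ; (suc (suc zero))          _ → IsSum⇒¬Unsum (next-b (3 + r) (≤-trans (m≤n+m _ 2) r≤) b₄)
      ; (suc (suc (suc zero)))    _ → IsSum⇒¬Unsum (at-b (4 + r) (≤-trans (m≤n+m _ 1) r≤) b₄)
      ; (suc (suc (suc (suc e)))) (s≤s (s≤s (s≤s (s≤s (s≤s ()))))) }
    block b r r≤ (b₂ , aa₃) =
      three r (≤-trans (n≤1+n _) r≤) b₂ (¬IsSum⇒Unsum z<s (aa (3 + r) z<s r≤ aa₃))

  walk : ∀ i → Center c (fib (5 + i)) →
         ∃ λ y → 2 + y ≡ fib (5 + i) + c × Walk Unsum x (2 ∷ W (suc i)) y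
  walk zero center = 3 + c , refl ,
    enter center ∷ three center 0 ≤-refl refl (¬IsSum⇒Unsum z<s (Center.end center (3 + c) refl)) ∷ []
  walk (suc i) center = 6 + σ N + c , cong (_+ c) L≡ ,
    enter center ∷ three center 0 (≤-trans (m≤m+n 5 _) (8+s≤L ≤-refl)) refl
      (¬IsSum⇒Unsum z<s (Center.aa center 3 z<s (≤-trans (m≤m+n 6 _) (8+s≤L ≤-refl)) (refl , refl)))
    ∷ (walk-applyUpTo (λ k → 3 + σ k + c) fibWord′ N next step ++ʷ (last ∷ []))
    where
    N : ℕ
    N = fib (3 + i) ∸ 2

    L≡ : 8 + σ N ≡ fib (6 + i)
    L≡ = σ-fib-2 i N (fib∸2 i)

    8+s≤L : ∀ {s} → s ≤ σ N → 8 + s ≤ fib (6 + i)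
    8+s≤L s≤ = ≤-trans (+-monoʳ-≤ 8 s≤) (≤-reflexive L≡)

    step : ∀ k → 3 + σ (suc k) + c ≡ fibWord′ k + (3 + σ k + c)
    step k = trans (cong (λ s → 3 + s + c) (σ-suc k)) (arrange (fibWord′ k) (σ k) c)
      where
      arrange : ∀ d s c → 3 + (d + s) + c ≡ d + (3 + s + c)
      arrange d s c = solve (d ∷ s ∷ c ∷ [])

    next : ∀ k → k < N → Next Unsum (3 + σ k + c) (fibWord′ k)
    next k k<N = block center (fibWord k) (3 + σ k)
      (bound (fibWord′ k) (σ k) _ (8+s≤L (subst (_≤ σ N) (σ-suc k) (σ-mono k<N)))) (fibWord-blocks k)
      where
      bound : ∀ d s L → 8 + (d + s) ≤ L → 3 + (d + (3 + s)) ≤ L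
      bound d s L h = ≤-linear 2 h (solve (d ∷ s ∷ L ∷ []))

    last : Next Unsum (3 + σ N + c) 3
    last = three center (3 + σ N) (8+s≤L ≤-refl)
      -- Position 5 + σ N is the mirror image of position 2, since 8 + σ N = F (i + 6); hence it
      -- carries b.
      (letter-mirror (6 + i) (5 + σ N) 2 z<s z<s (trans (+-comm (6 + σ N) 2) L≡))
      (¬IsSum⇒Unsum z<s (Center.end center (6 + σ N + c) (cong (_+ c) L≡)))

-- The sequence of gaps

initial : List ℕ
initial = 1 ∷ 1 ∷ 1 ∷ 1 ∷ 1 ∷ 2 ∷ 2 ∷ 1 ∷ 2 ∷ 1 ∷ []

-- The walk is checked by deciding `Unsum`. Its end 14 = 2 F 6 - 2 is two below the first centre.
initial-walk : Walk Unsum 1 initial 14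
initial-walk = one ∷ one ∷ one ∷ one ∷ one ∷ two ∷ two ∷ one ∷ two ∷ one ∷ []
  where
  one : ∀ {x} {_ : True (unsum? (1 + x))} → Next Unsum x 1
  one {x} {u} = z<s , toWitness u , λ { _ (s≤s ()) }
  two : ∀ {x} {_ : False (unsum? (1 + x))} {_ : True (unsum? (2 + x))} → Next Unsum x 2
  two {x} {¬u} {u} = z<s , toWitness u , λ { zero _ → toWitnessFalse ¬u ; (suc e) (s≤s (s≤s ())) }

private
  fib+double : ∀ p q → q + ((q + p) + (q + p)) ≡ q + p + q + (q + p)
  fib+double p q = solve (p ∷ q ∷ [])

  fib+fib : ∀ p q → q + (q + p + q + (q + p)) ≡ (q + p + q) + (q + p + q)
  fib+fib p q = solve (p ∷ q ∷ [])

-- Each round passes the centres 2 F (n + 6) and F (n + 8) and stops below 2 F (n + 7). Both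
-- distances to the next centre are F (n + 5), which is why every word occurs twice.
doubledBlocks-walk : ∀ n → ∃ λ y → 2 + y ≡ fib (6 + n) + fib (6 + n) ×
                     Walk Unsum 1 (initial ++ doubledBlocks W n) y
doubledBlocks-walk zero    = 14 , refl , initial-walk
doubledBlocks-walk (suc n)
  with y , y≡ , p ← doubledBlocks-walk n
  with z , z≡ , q ← block-walk n y y≡ (double-fib-center (suc n))
  with w , w≡ , r ← block-walk n z (trans z≡ (fib+double (fib (4 + n)) (fib (5 + n)))) (fib-center (suc n)) =
  w , trans w≡ (fib+fib (fib (4 + n)) (fib (5 + n))) ,
  subst (λ v → Walk Unsum 1 v w) (++-assoc initial (doubledBlocks W n) _) (p ++ʷ (q ++ʷ r))

n<fib : ∀ n → n < fib (2 + n)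
n<fib zero    = z<s
n<fib (suc n) = ≤-trans (≤-reflexive (+-comm 1 (suc n))) (+-mono-≤ (n<fib n) (1≤fib n))

-- Fibonacci numbers are unsums, and F (x + 2) exceeds x.
unsums-unbounded : ∀ x → ∃ λ n → Unsum (suc n + x)
unsums-unbounded x with n , eq ← <⇒∃ (n<fib x) =
  n , ¬IsSum⇒Unsum z<s λ (y , z , by , bz , _ , eq′) → fib-not-sum (2 + x) y z by bz (trans eq′ eq)

unsum-1 : Unsum 1
unsum-1 = toWitness {a? = unsum? 1} _

-- Properties of the words W

W-digits : ∀ i → All (λ d → d ≡ 3 ⊎ d ≡ 5) (W i)
W-digits 0             = All.[]
W-digits 1             = inj₁ refl All.∷ All.[]
W-digits (suc (suc i)) = inj₁ refl All.∷
  All.++⁺ (All.applyUpTo⁺₂ fibWord′ _ (digit-3⊎5 ∘ fibWord)) (inj₁ refl All.∷ All.[])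
  where
  digit-3⊎5 : ∀ c → digit c ≡ 3 ⊎ digit c ≡ 5
  digit-3⊎5 a = inj₂ refl
  digit-3⊎5 b = inj₁ refl

applyDownFrom≡applyUpTo : ∀ {A : Set} (f g : ℕ → A) n → (∀ i j → suc (i + j) ≡ n → f i ≡ g j) →
                          applyDownFrom f n ≡ applyUpTo g n
applyDownFrom≡applyUpTo f g zero    _     = refl
applyDownFrom≡applyUpTo f g (suc n) f≡g = cong₂ _∷_ (f≡g n 0 (cong suc (+-identityʳ n)))
  (applyDownFrom≡applyUpTo f (g ∘ suc) n (λ i j eq → f≡g i (suc j) (cong suc (trans (+-suc i j) eq))))

-- The middle is the palindromic prefix of `fibWord-mirror` written in digits, and it is framed by
-- equal letters.
W-palindrome : ∀ i → reverse (W i) ≡ W i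
W-palindrome 0             = refl
W-palindrome 1             = refl
W-palindrome (suc (suc i)) = begin
  reverse (3 ∷ P ++ [ 3 ])        ≡⟨ unfold-reverse 3 (P ++ [ 3 ]) ⟩
  reverse (P ++ [ 3 ]) ++ [ 3 ]   ≡⟨ cong (_++ [ 3 ]) (reverse-++ P [ 3 ]) ⟩
  3 ∷ reverse P ++ [ 3 ]          ≡⟨ cong (λ w → 3 ∷ w ++ [ 3 ]) P-palindrome ⟩
  3 ∷ P ++ [ 3 ]                  ∎
  where
  open ≡-Reasoning
  P : List ℕ
  P = applyUpTo fibWord′ (fib (3 + i) ∸ 2)
  P-palindrome : reverse P ≡ P
  P-palindrome = trans (reverse-applyUpTo fibWord′ _) (applyDownFrom≡applyUpTo fibWord′ fibWord′ _
    (λ j k eq → cong digit (fibWord-mirror (3 + i) j k (trans (cong (2 +_) eq) (fib∸2 i)))))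

length-W : ∀ i → length (W (suc i)) ≡ fib (2 + i)
length-W zero    = refl
length-W (suc i) = begin
  suc (length (applyUpTo fibWord′ (fib (3 + i) ∸ 2) ++ [ 3 ])) ≡⟨ cong suc (length-++ (applyUpTo fibWord′ (fib (3 + i) ∸ 2))) ⟩
  suc (length (applyUpTo fibWord′ (fib (3 + i) ∸ 2)) + 1)      ≡⟨ cong (λ l → suc (l + 1)) (length-applyUpTo fibWord′ _) ⟩
  suc (fib (3 + i) ∸ 2 + 1)                                     ≡⟨ cong suc (+-comm _ 1) ⟩
  2 + (fib (3 + i) ∸ 2)                                         ≡⟨ fib∸2 i ⟩
  fib (3 + i)                                                   ∎
  where open ≡-Reasoning

-- The two framing 3's and the added 2 make up the 8 in `σ-fib-2`.
sum-W : ∀ i → ListAction.sum (W (suc i)) + 2 ≡ fib (5 + i)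
sum-W zero    = refl
sum-W (suc i) = begin
  3 + ListAction.sum (applyUpTo fibWord′ N ++ [ 3 ]) + 2 ≡⟨ cong (λ s → 3 + s + 2) (sum-++ (applyUpTo fibWord′ N) [ 3 ]) ⟩
  3 + (σ N + 3) + 2                                      ≡⟨ arrange (σ N) ⟩
  8 + σ N                                                ≡⟨ σ-fib-2 i N (fib∸2 i) ⟩
  fib (6 + i)                                            ∎
  where
  open ≡-Reasoning
  N : ℕ
  N = fib (3 + i) ∸ 2
  arrange : ∀ s → 3 + (s + 3) + 2 ≡ 8 + s
  arrange s = solve (s ∷ [])

take-applyUpTo-++ : ∀ {A : Set} (f : ℕ → A) v {h n} → h ≤ n → take h (applyUpTo f n ++ v) ≡ applyUpTo f h
take-applyUpTo-++ f v z≤n       = refl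
take-applyUpTo-++ f v (s≤s h≤n) = cong (f 0 ∷_) (take-applyUpTo-++ (f ∘ suc) v h≤n)

take-W : ∀ i h → suc h < fib (3 + i) → take (suc h) (W (2 + i)) ≡ 3 ∷ applyUpTo fibWord′ h
take-W i h h< = cong (3 ∷_) (take-applyUpTo-++ fibWord′ [ 3 ] (∸-monoˡ-≤ 2 h<))

-- Without its last letter, each word is a prefix of 3 F′. For n ≥ 4, half of |W (n + 1)|, rounded
-- up, is less than |W n|, so the last letter of W n is not reached.
take-half-W : ∀ n → 3 ≤ n → let h = ⌈ length (W (suc n)) /2⌉ in take h (W (suc n)) ≡ take h (W n)
take-half-W 1 (s≤s ())
take-half-W 2 (s≤s (s≤s ()))
-- Here half of 5, rounded up, is all of W 3 = 353, whose last letter happens to agree with that of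
-- 35353.
take-half-W 3 _ = refl
take-half-W (suc (suc (suc (suc m)))) _ = agree _ half<
  where
  half< : ⌈ length (W (5 + m)) /2⌉ < fib (5 + m)
  half< with k , k≡ ← ≤⇒∃ (1≤fib (4 + m)) = ≤-trans (s≤s (≤-trans
    (⌈n/2⌉-mono (≤-trans (≤-reflexive (length-W (4 + m))) (bound k (fib (3 + m)) (fib (4 + m)) k≡ (2≤fib m))))
    (≤-reflexive (sym (n≡⌈n+n/2⌉ k))))) (≤-reflexive (trans (+-comm 1 k) k≡))
    where
    bound : ∀ k p q → k + 1 ≡ q + p → 2 ≤ p → q + p + q ≤ k + k
    bound k p q k≡ 2≤p = ≤-linear 0 (+-mono-≤ (≤-reflexive (sym (cong₂ _+_ k≡ k≡))) 2≤p) (solve (k ∷ p ∷ q ∷ []))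

  agree : ∀ h → h < fib (5 + m) → take h (W (5 + m)) ≡ take h (W (4 + m))
  agree zero    _  = refl
  agree (suc h) h< = trans (take-W (3 + m) h (≤-trans h< (m≤m+n _ _))) (sym (take-W (2 + m) h h<))

letterAt-applyUpTo-++ : ∀ {A : Set} (f : ℕ → A) v {k n} → k < n → letterAt (applyUpTo f n ++ v) k ≡ just (f k)
letterAt-applyUpTo-++ f v {zero}  (s≤s _)   = refl
letterAt-applyUpTo-++ f v {suc k} (s≤s k<n) = letterAt-applyUpTo-++ (f ∘ suc) v k<n

W-converges : W ConvergesTo (3 ◂ fibWord′)
W-converges zero    = 2 , λ { (suc (suc n)) _ → refl ; 1 (s≤s ()) }
-- For n = i + 2 ≥ k + 3 the middle part has F (i + 3) - 2 > k letters, so the closing 3 is not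
-- reached.
W-converges (suc k) = 3 + k , λ
  { (suc (suc i)) (s≤s (s≤s k<i)) →
      letterAt-applyUpTo-++ fibWord′ [ 3 ] (∸-monoˡ-≤ 2 (≤-trans (s≤s (s≤s k<i)) (n<fib (suc i)))) }

mainTheorem1 : (∃ λ u → IsIncreasingEnumeration Unsum u) ×
    ((u : ℕ → ℕ) → IsIncreasingEnumeration Unsum u →
    ∃ λ (W : ℕ → List ℕ) →
    (∀ i → 1 ≤ i → All (λ d → d ≡ 3 ⊎ d ≡ 5) (W i)) ×
    W 1 ≡ 3 ∷ [] ×
    W 2 ≡ 3 ∷ 3 ∷ [] ×
    W 3 ≡ 3 ∷ 5 ∷ 3 ∷ [] ×
    (gaps u IsDoubledConcatenationOf W After
    (1 ∷ 1 ∷ 1 ∷ 1 ∷ 1 ∷ 2 ∷ 2 ∷ 1 ∷ 2 ∷ 1 ∷ [])) ×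
    (∀ i → 1 ≤ i → reverse (W i) ≡ W i × length (W i) ≡ fib (i + 1)) ×
    (∀ i → 1 ≤ i → sum (W i) + 2 ≡ fib (i + 4)) ×
    (∀ n → 3 ≤ n →
    take ⌈ length (W (n + 1)) /2⌉ (W (n + 1)) ≡ take ⌈ length (W (n + 1)) /2⌉ (W n)) ×
    (W ConvergesTo (3 ◂ fibWord′)))
mainTheorem1 = enumeration-exists unsum? unsum-1 (λ m → proj₁) unsums-unbounded , λ u enum →
  W , (λ i _ → W-digits i) , refl , refl , refl , prefix u enum ,
  (λ { (suc i) _ → W-palindrome (suc i) , trans (length-W i) (cong fib (+-comm 1 (suc i))) }) ,
  (λ { (suc i) _ → trans (sum-W i) (cong fib (+-comm 4 (suc i))) }) ,
  (λ n 3≤n → subst (λ k → take ⌈ length (W k) /2⌉ (W k) ≡ take ⌈ length (W k) /2⌉ (W n))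
    (+-comm 1 n) (take-half-W n 3≤n)) ,
  W-converges
  where
  prefix : ∀ u → IsIncreasingEnumeration Unsum u → gaps u IsDoubledConcatenationOf W After initial
  prefix u enum n with y , _ , p ← doubledBlocks-walk n =
    walk-gaps enum 0 (gaps u) (λ i → cong (gaps u) (sym (+-identityʳ i)))
      (subst (λ x → Walk Unsum x (initial ++ doubledBlocks W n) y)
        (sym (first-element enum unsum-1 (λ m → proj₁))) p)
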